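{- Let $T$ be a rooted tree of depth $s$ that is a unit bar visibility graph. Then $T$ has at most $s^2+2s$ edges.
   Context: The depth of a rooted tree is the maximum distance from the root to a vertex. A finite simple graph is a unit bar visibility graph (UBVG) if its vertices can be represented by pairwise disjoint closed horizontal line segments ("bars") of unit length in the plane in such a way that two distinct vertices are adjacent if and only if there is an unobstructed non-degenerate (positive width) vertical band of visibility joining the two corresponding bars, i.e. an open interval $I$ of positive length such that for every $x_0\in I$ the line $x=x_0$ meets both bars and the part of this line strictly between them meets no other bar. -}

module Defs where

open import Data.Nat using (ℕ; zero; suc)
import Data.Nat as ℕ
open import Data.Rational using (ℚ; 0ℚ; 1ℚ; ∣_∣)
import Data.Rational as ℚ
import Data.Rational.Solver as ℚ-Solver
open import Data.Fin using (Fin; _<?_)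
open import Data.List using (List; _∷_; _∷ʳ_; length; filter; allFin; cartesianProduct)
open import Data.List.Relation.Unary.Linked using (Linked)
open import Data.List.Relation.Unary.Unique.Propositional using (Unique)
open import Data.Product using (_×_; _,_; ∃-syntax)
open import Data.Sum using (_⊎_)
open import Function.Bundles using (_⇔_)
open import Relation.Binary using (Decidable; Symmetric; Irreflexive)
open import Relation.Binary.PropositionalEquality using (_≡_; _≢_; refl; subst; sym; cong)
open import Relation.Nullary using (¬_)
open import Relation.Nullary.Decidable using (_×-dec_)

-- Real numbers, as Cauchy sequences of rationals. Equality of reals is _≈_.

IsCauchy : (ℕ → ℚ) → Set
IsCauchy a = ∀ ε → 0ℚ ℚ.< ε →
  ∃[ N ] (∀ m n → N ℕ.≤ m → N ℕ.≤ n → ∣ a m ℚ.- a n ∣ ℚ.< ε)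

record ℝ : Set where
  constructor mkℝ
  field
    seq    : ℕ → ℚ
    cauchy : IsCauchy seq

open ℝ public

infix 4 _<_ _≤_ _≈_

_<_ : ℝ → ℝ → Set
x < y = ∃[ ε ] (0ℚ ℚ.< ε × ∃[ N ] (∀ n → N ℕ.≤ n → seq x n ℚ.+ ε ℚ.≤ seq y n))

_≤_ : ℝ → ℝ → Set
x ≤ y = ¬ (y < x)

_≈_ : ℝ → ℝ → Set
x ≈ y = x ≤ y × y ≤ x

private
  shift-diff : ∀ p q r → (p ℚ.+ r) ℚ.- (q ℚ.+ r) ≡ p ℚ.- q
  shift-diff = solve 3 (λ p q r → (p :+ r) :- (q :+ r) := p :- q) refl
    where open ℚ-Solver.+-*-Solver

infixl 6 _+ℚ_

_+ℚ_ : ℝ → ℚ → ℝ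
seq    (x +ℚ q) n = seq x n ℚ.+ q
cauchy (x +ℚ q) ε ε>0 with cauchy x ε ε>0
... | N , close = N , λ m n N≤m N≤n →
  subst (ℚ._< ε) (cong ∣_∣ (sym (shift-diff (seq x m) (seq x n) q))) (close m n N≤m N≤n)

-- The closed segment from (left , height) to (left + 1 , height).

record UnitBar : Set where
  constructor mkBar
  field
    left   : ℝ
    height : ℝ

open UnitBar public

infix 4 _∈ᵇ_

_∈ᵇ_ : ℝ × ℝ → UnitBar → Set
(x , y) ∈ᵇ b = left b ≤ x × x ≤ left b +ℚ 1ℚ × y ≈ height b

Disjoint : UnitBar → UnitBar → Set
Disjoint b c = ∀ p → ¬ (p ∈ᵇ b × p ∈ᵇ c)

VerticalLineMeets : ℝ → UnitBar → Set
VerticalLineMeets x b = ∃[ y ] ((x , y) ∈ᵇ b)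

StrictlyBetween : ℝ → ℝ → ℝ → Set
StrictlyBetween y c d = (c < y × y < d) ⊎ (d < y × y < c)

Visible : ∀ {n} → (Fin n → UnitBar) → Fin n → Fin n → Set
Visible bar u v = ∃[ a ] ∃[ b ] (a < b × (∀ x → a < x → x < b →
  VerticalLineMeets x (bar u) × VerticalLineMeets x (bar v) ×
  (∀ w → w ≢ u → w ≢ v →
   ∀ y → StrictlyBetween y (height (bar u)) (height (bar v)) → ¬ ((x , y) ∈ᵇ bar w))))

record SimpleGraph (n : ℕ) : Set₁ where
  field
    Adj    : Fin n → Fin n → Set
    adj?   : Decidable Adj
    symm   : Symmetric Adj
    irrefl : Irreflexive _≡_ Adj

IsUBVG : ∀ {n} → SimpleGraph n → Set
IsUBVG {n} G = ∃[ bar ]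
  ((∀ u v → u ≢ v → Disjoint (bar u) (bar v)) ×
   (∀ u v → u ≢ v → SimpleGraph.Adj G u v ⇔ Visible bar u v))

module _ {n : ℕ} (G : SimpleGraph n) where
  open SimpleGraph G

  -- Each edge is listed once, with its smaller endpoint first.
  edges : List (Fin n × Fin n)
  edges = filter (λ (i , j) → (i <? j) ×-dec adj? i j)
                 (cartesianProduct (allFin n) (allFin n))

  edgeCount : ℕ
  edgeCount = length edges

  data Walk : Fin n → Fin n → ℕ → Set where
    stay : ∀ {u} → Walk u u zero
    step : ∀ {u v w k} → Adj u v → Walk v w k → Walk u w (suc k)

  IsDistance : Fin n → Fin n → ℕ → Set
  IsDistance u v d = Walk u v d × (∀ k → Walk u v k → d ℕ.≤ k)

  Connected : Set
  Connected = ∀ u v → ∃[ k ] Walk u v k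

  -- The cycle visits v, then the vertices of vs in order, then returns to v.
  record IsCycle (v : Fin n) (vs : List (Fin n)) : Set where
    field
      long   : 3 ℕ.≤ length (v ∷ vs)
      simple : Unique (v ∷ vs)
      closed : Linked Adj (v ∷ vs ∷ʳ v)

  Acyclic : Set
  Acyclic = ∀ v vs → ¬ IsCycle v vs

record RootedTree (n : ℕ) : Set₁ where
  field
    graph     : SimpleGraph n
    connected : Connected graph
    acyclic   : Acyclic graph
    root      : Fin n

HasDepth : ∀ {n} → RootedTree n → ℕ → Set
HasDepth T s =
  (∀ v d → IsDistance graph root v d → d ℕ.≤ s) × (∃[ v ] IsDistance graph root v s)
  where open RootedTree T

{-# OPTIONS --safe #-}
module Submission where

-- Work with left ends X and heights Y, and let a column be the set of bars met just to the
-- right of an abscissa. Consecutive bars of a column see each other, so columns are connected.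
-- As edges of a tree are bridges, at most one edge crosses any given abscissa t: two crossing
-- edges would be joined by the disjoint columns at t and t + 1. Bridges also forbid a third
-- neighbour once two neighbours are aligned with a bar, so every vertex has degree at most 3,
-- and one of degree 3 has a neighbour on its left and a neighbour on its right. By uniqueness
-- of the crossing edge, a vertex of this kind separates the bars on its two sides, hence each
-- level of the tree has at most one of them with X ≤ X(root) and at most one with X > X(root).
-- So levels grow by at most 2, level d has at most 2d + 1 vertices, and in all there are at
-- most (s + 1)² vertices. Reals are compared under a double negation, which the
-- decidable conclusion absorbs.

open import Data.Nat using (ℕ; zero; suc; _+_; _*_; _^_; _≤_)
open import Defs using (RootedTree; HasDepth; IsUBVG; edgeCount)
open import Defs using (ℝ; seq; cauchy; _+ℚ_; UnitBar; left; height; Disjoint; Visible)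
  renaming (_<_ to _<ʳ_; _≤_ to _≤ʳ_)
open import Defs using (SimpleGraph; Acyclic; Connected; Walk; stay; step; IsDistance; edges)

open import Data.Bool using (if_then_else_)
open import Data.Empty using (⊥; ⊥-elim)
open import Data.Fin as Fin using (Fin; _≟_; zero; suc)
import Data.Fin.Properties as Fin
open import Data.List using (List; []; _∷_; _∷ʳ_; _++_; map; allFin; cartesianProduct; length; lookup)
open import Data.List.Membership.Propositional using (_∈_)
open import Data.List.Membership.Propositional.Properties
  using (∈-++⁺ˡ; ∈-++⁺ʳ; ∈-map⁺; ∈-allFin; ∈-lookup; ∈-filter⁻)
open import Data.List.Relation.Unary.All as All using ([]; _∷_)
open import Data.List.Relation.Unary.All.Properties using (¬Any⇒All¬)
open import Data.List.Relation.Unary.AllPairs using ([]; _∷_)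
open import Data.List.Relation.Unary.Any using (here; there; any?)
open import Data.List.Relation.Unary.Linked as Linked using (Linked; [-]; _∷_)
open import Data.List.Relation.Unary.Unique.Propositional using (Unique)
import Data.List.Relation.Unary.Unique.Propositional.Properties as Unique
import Data.Nat as ℕ
import Data.Nat.Properties as ℕ
open import Data.Nat.Solver using (module +-*-Solver)
open import Data.Product using (_×_; _,_; proj₁; proj₂; ∃-syntax; swap)
open import Data.Rational as ℚ using (ℚ; 0ℚ; 1ℚ; ½)
import Data.Rational.Properties as ℚ
import Data.Rational.Solver as ℚ-Solver
open import Data.Sum as Sum using (_⊎_; inj₁; inj₂; [_,_]′)
open import Effect.Monad using (RawMonad)
open import Function using (id; _∘_)
open import Function.Bundles using (_⇔_; Equivalence)
open import Level using (0ℓ)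
open import Relation.Binary using (Rel; Decidable; Transitive; tri<; tri≈; tri>)
open import Relation.Binary.Construct.Closure.ReflexiveTransitive as Star using (Star; _◅_; _◅◅_)
open import Relation.Binary.PropositionalEquality
open import Relation.Nullary using (¬_; Dec; yes; no; does)
open import Relation.Nullary.Decidable
  using (¬¬-excluded-middle; decidable-stable; from-yes; ¬?; _×-dec_; _⊎-dec_; _→-dec_)
open import Relation.Nullary.Negation using (¬¬-Monad)

-- Order on the reals

halve : ∀ {ε} → 0ℚ ℚ.< ε → ∃[ δ ] (0ℚ ℚ.< δ × δ ℚ.+ δ ≡ ε)
halve {ε} ε>0 = ½ ℚ.* ε ,
  subst (ℚ._< ½ ℚ.* ε) (ℚ.*-zeroʳ ½) (ℚ.*-monoʳ-<-pos ½ ε>0) ,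
  trans (sym (ℚ.*-distribʳ-+ ε ½ ½)) (ℚ.*-identityˡ ε)

p<p+ε : ∀ p {ε} → 0ℚ ℚ.< ε → p ℚ.< p ℚ.+ ε
p<p+ε p {ε} ε>0 = subst (ℚ._< p ℚ.+ ε) (ℚ.+-identityʳ p) (ℚ.+-monoʳ-< p ε>0)

p≤∣p∣ : ∀ p → p ℚ.≤ ℚ.∣ p ∣
p≤∣p∣ p with ℚ.≤-total 0ℚ p
... | inj₁ 0≤p = ℚ.≤-reflexive (sym (ℚ.0≤p⇒∣p∣≡p 0≤p))
... | inj₂ p≤0 = ℚ.≤-trans p≤0 (ℚ.0≤∣p∣ p)

+-cancelʳ-≤ : ∀ r {p q} → p ℚ.+ r ℚ.≤ q ℚ.+ r → p ℚ.≤ q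
+-cancelʳ-≤ r {p} {q} le =
  subst₂ ℚ._≤_ (cancel p r) (cancel q r) (ℚ.+-monoˡ-≤ (ℚ.- r) le)
  where
  open ℚ-Solver.+-*-Solver
  cancel : ∀ a b → a ℚ.+ b ℚ.+ ℚ.- b ≡ a
  cancel = solve 2 (λ a b → a :+ b :+ :- b := a) refl

close⇒≤ : ∀ {p q δ} → ℚ.∣ p ℚ.- q ∣ ℚ.< δ → p ℚ.≤ q ℚ.+ δ
close⇒≤ {p} {q} {δ} near = begin
  p                ≡⟨ split p q ⟩
  q ℚ.+ (p ℚ.- q)  ≤⟨ ℚ.+-monoʳ-≤ q (ℚ.≤-trans (p≤∣p∣ (p ℚ.- q)) (ℚ.<⇒≤ near)) ⟩
  q ℚ.+ δ          ∎
  where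
  open ℚ.≤-Reasoning
  open ℚ-Solver.+-*-Solver
  split : ∀ a b → a ≡ b ℚ.+ (a ℚ.- b)
  split = solve 2 (λ a b → a := b :+ (a :- b)) refl

modulus : ∀ (x : ℝ) {δ} → 0ℚ ℚ.< δ →
  ∃[ N ] (∀ m n → N ≤ m → N ≤ n → seq x m ℚ.≤ seq x n ℚ.+ δ)
modulus x δ>0 with cauchy x _ δ>0
... | N , close = N , λ m n N≤m N≤n → close⇒≤ (close m n N≤m N≤n)

≤-from-samples : ∀ {xm xn yn ym η δ : ℚ} → δ ℚ.+ δ ≡ η → xm ℚ.≤ xn ℚ.+ δ → yn ℚ.≤ ym ℚ.+ δ →
  xn ℚ.+ (η ℚ.+ η) ℚ.≤ yn → xm ℚ.+ η ℚ.≤ ym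
≤-from-samples {xm} {xn} {yn} {ym} {η} {δ} eq p q gap = +-cancelʳ-≤ δ
  (ℚ.≤-trans step₁ (ℚ.≤-trans (ℚ.≤-reflexive step₂) (ℚ.≤-trans gap q)))
  where
  regroup : ∀ a b c d → a ℚ.+ b ℚ.+ c ℚ.+ d ≡ a ℚ.+ (c ℚ.+ (b ℚ.+ d))
  regroup = solve 4 (λ a b c d → a :+ b :+ c :+ d := a :+ (c :+ (b :+ d))) refl
    where open ℚ-Solver.+-*-Solver
  step₁ : xm ℚ.+ η ℚ.+ δ ℚ.≤ xn ℚ.+ δ ℚ.+ η ℚ.+ δ
  step₁ = ℚ.+-monoˡ-≤ δ (ℚ.+-monoˡ-≤ η p)
  step₂ : xn ℚ.+ δ ℚ.+ η ℚ.+ δ ≡ xn ℚ.+ (η ℚ.+ η)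
  step₂ = trans (regroup xn δ η δ) (cong (λ e → xn ℚ.+ (η ℚ.+ e)) eq)

swap-last : ∀ p q r → p ℚ.+ q ℚ.+ r ≡ p ℚ.+ r ℚ.+ q
swap-last = solve 3 (λ p q r → p :+ q :+ r := p :+ r :+ q) refl
  where open ℚ-Solver.+-*-Solver

-- Sealing the order lets the endpoints of an inequality be inferred from its type.
infix 4 _≺_ _≼_

abstract
  _≺_ : ℝ → ℝ → Set
  _≺_ = _<ʳ_

  ≺⇒<ʳ : ∀ {x y} → x ≺ y → x <ʳ y
  ≺⇒<ʳ x≺y = x≺y

  <ʳ⇒≺ : ∀ {x y} → x <ʳ y → x ≺ y
  <ʳ⇒≺ x<y = x<y

  -- Past the moduli for `δ`, a quarter of `ε`, each sequence moves by at most `δ`, so a gap `ε` at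
  -- one index leaves half of it at all later ones.
  ≺-from-gap : ∀ x y {ε} → 0ℚ ℚ.< ε → ∃[ N ] (∀ n → N ≤ n → seq x n ℚ.+ ε ℚ.≤ seq y n → x ≺ y)
  ≺-from-gap x y {ε} ε>0 =
    let η , η>0 , η+η≡ε = halve ε>0
        δ , δ>0 , δ+δ≡η = halve η>0
        N₁ , close-x = modulus x δ>0
        N₂ , close-y = modulus y δ>0
    in N₁ ℕ.⊔ N₂ , λ n N≤n gap →
      let N₁≤n = ℕ.≤-trans (ℕ.m≤m⊔n N₁ N₂) N≤n
          N₂≤n = ℕ.≤-trans (ℕ.m≤n⊔m N₁ N₂) N≤n
      in η , η>0 , n , λ m n≤m →
        ≤-from-samples {xn = seq x n} {yn = seq y n} δ+δ≡η (close-x m n (ℕ.≤-trans N₁≤n n≤m) N₁≤n)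
          (close-y n m N₂≤n (ℕ.≤-trans N₂≤n n≤m))
          (subst (λ e → seq x n ℚ.+ e ℚ.≤ seq y n) (sym η+η≡ε) gap)

  ≺-irrefl : ∀ {x} → ¬ (x ≺ x)
  ≺-irrefl {x} (ε , ε>0 , N , gap) =
    ℚ.<-irrefl refl (ℚ.<-≤-trans (p<p+ε (seq x N) ε>0) (gap N ℕ.≤-refl))

  ≺-trans : ∀ {x y z} → x ≺ y → y ≺ z → x ≺ z
  ≺-trans (ε , ε>0 , N , gap) (ε′ , ε′>0 , N′ , gap′) = ε , ε>0 , N ℕ.⊔ N′ , λ n le →
    ℚ.≤-trans (gap n (ℕ.≤-trans (ℕ.m≤m⊔n N N′) le))
      (ℚ.≤-trans (ℚ.<⇒≤ (p<p+ε _ ε′>0)) (gap′ n (ℕ.≤-trans (ℕ.m≤n⊔m N N′) le)))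

  -- Stands in for trichotomy: at one late index the rationals can be compared, and `≺-from-gap`
  -- turns either outcome into an inequality of reals.
  ≺-cotrans : ∀ {x z} → x ≺ z → ∀ y → x ≺ y ⊎ y ≺ z
  ≺-cotrans {x} {z} (ε , ε>0 , N , gap) y =
    let η , η>0 , η+η≡ε = halve ε>0
        N₁ , below = ≺-from-gap x y η>0
        N₂ , above = ≺-from-gap y z η>0
        M = N ℕ.⊔ (N₁ ℕ.⊔ N₂)
        N₁≤M = ℕ.≤-trans (ℕ.m≤m⊔n N₁ N₂) (ℕ.m≤n⊔m N _)
        N₂≤M = ℕ.≤-trans (ℕ.m≤n⊔m N₁ N₂) (ℕ.m≤n⊔m N _)
    in Sum.map (below M N₁≤M)
         (λ ge → above M N₂≤M (begin
           seq y M ℚ.+ η          ≤⟨ ℚ.+-monoˡ-≤ η ge ⟩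
           seq x M ℚ.+ η ℚ.+ η    ≡⟨ ℚ.+-assoc (seq x M) η η ⟩
           seq x M ℚ.+ (η ℚ.+ η)  ≡⟨ cong (seq x M ℚ.+_) η+η≡ε ⟩
           seq x M ℚ.+ ε          ≤⟨ gap M (ℕ.m≤m⊔n N _) ⟩
           seq z M                ∎))
         (ℚ.≤-total (seq x M ℚ.+ η) (seq y M))
    where open ℚ.≤-Reasoning

  ≺-dense : ∀ {x z} → x ≺ z → ∃[ y ] (x ≺ y × y ≺ z)
  ≺-dense {x} {z} (ε , ε>0 , N , gap) =
    let η , η>0 , η+η≡ε = halve ε>0 in
    x +ℚ η ,
    (η , η>0 , 0 , λ n _ → ℚ.≤-refl) ,
    (η , η>0 , N , λ n N≤n → subst (ℚ._≤ seq z n)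
      (trans (cong (seq x n ℚ.+_) (sym η+η≡ε)) (sym (ℚ.+-assoc (seq x n) η η))) (gap n N≤n))

  x≺x+1 : ∀ {x} → x ≺ x +ℚ 1ℚ
  x≺x+1 = 1ℚ , ℚ.positive⁻¹ 1ℚ , 0 , λ n _ → ℚ.≤-refl

  +1-mono-≺ : ∀ {x y} → x ≺ y → x +ℚ 1ℚ ≺ y +ℚ 1ℚ
  +1-mono-≺ {x} {y} (ε , ε>0 , N , gap) = ε , ε>0 , N , λ n N≤n →
    subst (ℚ._≤ seq y n ℚ.+ 1ℚ) (swap-last (seq x n) ε 1ℚ) (ℚ.+-monoˡ-≤ 1ℚ (gap n N≤n))

  +1-cancel-≺ : ∀ {x y} → x +ℚ 1ℚ ≺ y +ℚ 1ℚ → x ≺ y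
  +1-cancel-≺ {x} {y} (ε , ε>0 , N , gap) = ε , ε>0 , N , λ n N≤n →
    +-cancelʳ-≤ 1ℚ (subst (ℚ._≤ seq y n ℚ.+ 1ℚ) (swap-last (seq x n) 1ℚ ε) (gap n N≤n))

_≼_ : ℝ → ℝ → Set
x ≼ y = ¬ (y ≺ x)

≼⇒≤ʳ : ∀ {x y} → x ≼ y → x ≤ʳ y
≼⇒≤ʳ x≼y y<x = x≼y (<ʳ⇒≺ y<x)

≤ʳ⇒≼ : ∀ {x y} → x ≤ʳ y → x ≼ y
≤ʳ⇒≼ x≤y y≺x = x≤y (≺⇒<ʳ y≺x)

≺-≼-trans : ∀ {x y z} → x ≺ y → y ≼ z → x ≺ z
≺-≼-trans {z = z} x≺y y≼z = [ id , ⊥-elim ∘ y≼z ]′ (≺-cotrans x≺y z)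

≼-≺-trans : ∀ {x y z} → x ≼ y → y ≺ z → x ≺ z
≼-≺-trans {x = x} x≼y y≺z = [ ⊥-elim ∘ x≼y , id ]′ (≺-cotrans y≺z x)

≼-trans : ∀ {x y z} → x ≼ y → y ≼ z → x ≼ z
≼-trans x≼y y≼z z≺x = y≼z (≺-≼-trans z≺x x≼y)

≺⇒≼ : ∀ {x y} → x ≺ y → x ≼ y
≺⇒≼ x≺y y≺x = ≺-irrefl (≺-trans x≺y y≺x)

+1-mono-≼ : ∀ {x y} → x ≼ y → x +ℚ 1ℚ ≼ y +ℚ 1ℚ
+1-mono-≼ x≼y = x≼y ∘ +1-cancel-≺

≼-refl : ∀ {x} → x ≼ x
≼-refl = ≺-irrefl

≤ʳ-refl : ∀ x → x ≤ʳ x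
≤ʳ-refl x = ≼⇒≤ʳ {x} ≼-refl

-- Choosing b takes case distinctions on reals, hence the double negation.
next-above : ∀ t (ps : List ℝ) → ¬ ¬ (∃[ b ] (t ≺ b × (∀ {p} → p ∈ ps → t ≺ p → b ≼ p)))
next-above t [] k = k (t +ℚ 1ℚ , x≺x+1 , λ ())
next-above t (p ∷ ps) k = next-above t ps λ (b , t<b , least) →
  ¬¬-excluded-middle {A = t ≺ p × p ≺ b} λ
    { (yes (t<p , p<b)) → k (p , t<p , λ
        { (here refl) _ → ≺-irrefl
        ; (there q∈) t<q → ≼-trans (≺⇒≼ p<b) (least q∈ t<q) })
    ; (no ¬p) → k (b , t<b , λ
        { (here refl) t<p p<b → ¬p (t<p , p<b)
        ; (there q∈) → least q∈ }) }

-- Bridges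

module _ {n : ℕ} {R : Rel (Fin n) 0ℓ} where

  -- `ps` holds the interior vertices. The end `a` comes first in the uniqueness list so that an
  -- edge from `a` to `u` closes the path in the format of `IsCycle`.
  SimplePath : Fin n → Fin n → Set
  SimplePath u a = ∃[ ps ] (Linked R (u ∷ ps ∷ʳ a) × Unique (a ∷ u ∷ ps))

  drop-to : ∀ {u v a} ps → Linked R (v ∷ ps ∷ʳ a) → Unique (a ∷ v ∷ ps) → u ∈ v ∷ ps → SimplePath u a
  drop-to ps linked unique (here refl) = ps , linked , unique
  drop-to (_ ∷ ps) (_ ∷ linked) ((_ ∷ a∉) ∷ (_ ∷ unique)) (there u∈) =
    drop-to ps linked (a∉ ∷ unique) u∈

  -- Loops are erased from the far end: if the new first vertex already lies on the path, `drop-to`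
  -- cuts the path there.
  erase-loops : ∀ {u a} → u ≢ a → Star R u a → SimplePath u a
  erase-loops u≢a Star.ε = ⊥-elim (u≢a refl)
  erase-loops {u} {a} u≢a (_◅_ {j = v} r rs) with v ≟ a
  ... | yes refl = [] , r ∷ [-] , ((u≢a ∘ sym) ∷ []) ∷ [] ∷ []
  ... | no v≢a with erase-loops v≢a rs
  ...   | ps , linked , unique@(a∉ ∷ unique′) with any? (u ≟_) (v ∷ ps)
  ...     | yes u∈ = drop-to ps linked unique u∈
  ...     | no u∉  = v ∷ ps , r ∷ linked , ((u≢a ∘ sym) ∷ a∉) ∷ ¬Any⇒All¬ _ u∉ ∷ unique′

module _ {n : ℕ} (G : SimpleGraph n) where
  open SimpleGraph G

  AdjOff : Fin n → Fin n → Rel (Fin n) 0ℓ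
  AdjOff a c u v = Adj u v × ¬ (u ≡ a × v ≡ c) × ¬ (u ≡ c × v ≡ a)

  edge-is-bridge : Acyclic G → ∀ {a c} → Adj a c → ¬ Star (AdjOff a c) c a
  edge-is-bridge acyclic {a} {c} a~c walk with erase-loops (λ c≡a → irrefl (sym c≡a) a~c) walk
  -- Without interior vertices the path would be the removed edge itself; with one, the cycle is
  -- long enough.
  ... | [] , (_ , _ , not-ca) ∷ _ , _ = not-ca (refl , refl)
  ... | p ∷ ps , linked , unique = acyclic a (c ∷ p ∷ ps) record
    { long   = ℕ.s≤s (ℕ.s≤s (ℕ.s≤s ℕ.z≤n))
    ; simple = unique
    ; closed = a~c ∷ Linked.map proj₁ linked
    }

-- Geometry of a layout of unit bars

module Layout {n : ℕ} (G : SimpleGraph n) (acyclic : Acyclic G) (bar : Fin n → UnitBar)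
  (disjoint : ∀ u v → u ≢ v → Disjoint (bar u) (bar v))
  (adj⇔visible : ∀ u v → u ≢ v → SimpleGraph.Adj G u v ⇔ Visible bar u v) where

  open SimpleGraph G

  X Y : Fin n → ℝ
  X u = left (bar u)
  Y u = height (bar u)

  infix 4 _∋_ _◃_

  _∋_ : Fin n → ℝ → Set
  u ∋ x = X u ≼ x × x ≼ X u +ℚ 1ℚ

  _◃_ : Rel (Fin n) 0ℓ
  u ◃ v = X u ≺ X v

  Aligned : Rel (Fin n) 0ℓ
  Aligned u v = ¬ u ◃ v × ¬ v ◃ u

  Between : Fin n → Fin n → Fin n → Set
  Between u w v = (Y u ≺ Y w × Y w ≺ Y v) ⊎ (Y v ≺ Y w × Y w ≺ Y u)

  heights-differ : ∀ {u v x} → u ≢ v → u ∋ x → v ∋ x → Y v ≼ Y u → ¬ Y u ≼ Y v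
  heights-differ {u} {v} {x} u≢v (lu , ru) (lv , rv) Yv≼Yu Yu≼Yv = disjoint u v u≢v (x , Y u)
    ( (≼⇒≤ʳ lu , ≼⇒≤ʳ ru , ≤ʳ-refl (Y u) , ≤ʳ-refl (Y u))
    , (≼⇒≤ʳ lv , ≼⇒≤ʳ rv , ≼⇒≤ʳ Yu≼Yv , ≼⇒≤ʳ Yv≼Yu) )

  adj⇒≢ : ∀ {u v} → Adj u v → u ≢ v
  adj⇒≢ u~v u≡v = irrefl u≡v u~v

  visible : ∀ {u v} → Adj u v → Visible bar u v
  visible {u} {v} u~v = Equivalence.to (adj⇔visible u v (adj⇒≢ u~v)) u~v

  -- Two abscissae of the band are kept because its positive width is what makes `overlapping`
  -- strict.
  sight : ∀ {u v} → Adj u v → ∃[ x ] ∃[ x′ ] (x ≺ x′ × (u ∋ x × v ∋ x) × (u ∋ x′ × v ∋ x′) ×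
    (∀ {w} → w ≢ u → w ≢ v → w ∋ x → ¬ Between u w v))
  sight {u} {v} u~v =
    let a , b , a<b , seen = visible u~v
        x , a≺x , x≺b = ≺-dense (<ʳ⇒≺ {a} {b} a<b)
        x′ , x≺x′ , x′≺b = ≺-dense x≺b
        (_ , lu , ru , _) , (_ , lv , rv , _) , free = seen x (≺⇒<ʳ a≺x) (≺⇒<ʳ x≺b)
        (_ , lu′ , ru′ , _) , (_ , lv′ , rv′ , _) , _ = seen x′ (≺⇒<ʳ (≺-trans a≺x x≺x′)) (≺⇒<ʳ x′≺b)
    in x , x′ , x≺x′ ,
       ((≤ʳ⇒≼ lu , ≤ʳ⇒≼ ru) , (≤ʳ⇒≼ lv , ≤ʳ⇒≼ rv)) ,
       ((≤ʳ⇒≼ lu′ , ≤ʳ⇒≼ ru′) , (≤ʳ⇒≼ lv′ , ≤ʳ⇒≼ rv′)) ,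
       λ {w} w≢u w≢v (lw , rw) between → free w w≢u w≢v (Y w)
         (Sum.map (λ (p , q) → ≺⇒<ʳ p , ≺⇒<ʳ q) (λ (p , q) → ≺⇒<ʳ p , ≺⇒<ʳ q) between)
         (≼⇒≤ʳ lw , ≼⇒≤ʳ rw , ≤ʳ-refl (Y w) , ≤ʳ-refl (Y w))

  overlapping : ∀ {u v} → Adj u v → X u ≺ X v +ℚ 1ℚ
  overlapping u~v = let x , x′ , x≺x′ , ((lu , _) , _) , (_ , (_ , rv)) , _ = sight u~v in
    ≼-≺-trans lu (≺-≼-trans x≺x′ rv)

  -- An aligned bar covers all abscissae of `v`, so at an intermediate height it cuts the line of
  -- sight to `r`.
  aligned-blocks : ∀ {v u r} → Aligned v u → Adj v r → u ≢ v → u ≢ r → ¬ Between v u r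
  aligned-blocks (¬vu , ¬uv) v~r u≢v u≢r =
    let x , _ , _ , ((lv , rv) , _) , _ , free = sight v~r in
    free u≢v u≢r (≼-trans ¬vu lv , ≼-trans rv (+1-mono-≼ ¬uv))

  -- The bars met by the vertical lines just to the right of abscissa t.
  Column : ℝ → Fin n → Set
  Column t u = X u ≼ t × t ≺ X u +ℚ 1ℚ

  Column⇒∋ : ∀ {t u} → Column t u → u ∋ t
  Column⇒∋ (l , r) = l , ≺⇒≼ r

  -- The abscissae at which a column can change.
  ends : List ℝ
  ends = map X (allFin n) ++ map (λ u → X u +ℚ 1ℚ) (allFin n)

  X∈ends : ∀ u → X u ∈ ends
  X∈ends u = ∈-++⁺ˡ (∈-map⁺ X (∈-allFin u))

  X+1∈ends : ∀ u → X u +ℚ 1ℚ ∈ ends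
  X+1∈ends u = ∈-++⁺ʳ (map X (allFin n)) (∈-map⁺ (λ u → X u +ℚ 1ℚ) (∈-allFin u))

  Slab : ℝ → ℝ → ℝ → Fin n → Set
  Slab t lo hi w = Column t w × lo ≼ Y w × Y w ≼ hi

  -- The band runs from `t` to the next abscissa `b` in `ends`. No bar starts or stops inside it, so
  -- an obstructing bar would already belong to the column at `t`.
  consecutive⇒adj : ∀ {t u v} → Column t u → Column t v → Y u ≺ Y v →
    (∀ {w} → Column t w → Y u ≺ Y w → ¬ Y w ≺ Y v) → ¬ ¬ Adj u v
  consecutive⇒adj {t} {u} {v} (lu , ru) (lv , rv) Yu≺Yv empty k = next-above t ends λ (b , t≺b , least) →
    let spans : ∀ {z x} → X z ≼ t → t ≺ X z +ℚ 1ℚ → t ≺ x → x ≺ b → z ∋ x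
        spans {z} l r t≺x x≺b = ≼-trans l (≺⇒≼ t≺x) , ≼-trans (≺⇒≼ x≺b) (least (X+1∈ends z) r)
        meets : ∀ {z x} → z ∋ x → ∃[ y ] _
        meets {z} (l , r) = Y z , ≼⇒≤ʳ l , ≼⇒≤ʳ r , ≤ʳ-refl (Y z) , ≤ʳ-refl (Y z)
    in k (Equivalence.from (adj⇔visible u v (λ { refl → ≺-irrefl Yu≺Yv }))
      (t , b , ≺⇒<ʳ t≺b , λ x t<x x<b →
        let t≺x = <ʳ⇒≺ {t} {x} t<x
            x≺b = <ʳ⇒≺ {x} {b} x<b
        in meets (spans lu ru t≺x x≺b) , meets (spans lv rv t≺x x≺b) ,
        λ w _ _ y between (lw , rw , y≤Yw , Yw≤y) →
          let inside : Column t w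
              inside = (λ t≺Xw → ≤ʳ⇒≼ {X w} {x} lw (≺-≼-trans x≺b (least (X∈ends w) t≺Xw))) ,
                       ≺-≼-trans t≺x (≤ʳ⇒≼ {x} {X w +ℚ 1ℚ} rw)
              y≼Yw = ≤ʳ⇒≼ {y} {Y w} y≤Yw
              Yw≼y = ≤ʳ⇒≼ {Y w} {y} Yw≤y
          in [ (λ (Yu<y , y<Yv) → empty inside
                 (≺-≼-trans (<ʳ⇒≺ {Y u} {y} Yu<y) y≼Yw) (≼-≺-trans Yw≼y (<ʳ⇒≺ {y} {Y v} y<Yv)))
             , (λ (Yv<y , y<Yu) → ≺-irrefl
                 (≺-trans Yu≺Yv (≺-trans (<ʳ⇒≺ {Y v} {y} Yv<y) (<ʳ⇒≺ {y} {Y u} y<Yu)))) ]′ between))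

  Within : (Fin n → Set) → Rel (Fin n) 0ℓ
  Within P u v = Adj u v × P u × P v

  Within-reverse : ∀ {P u v} → Star (Within P) u v → Star (Within P) v u
  Within-reverse = Star.reverse λ (u~v , Pu , Pv) → symm u~v , Pv , Pu

  Within-map : ∀ {P Q : Fin n → Set} {u v} → (∀ {w} → P w → Q w) → Star (Within P) u v → Star (Within Q) u v
  Within-map f = Star.map λ (u~v , Pu , Pv) → u~v , f Pu , f Pv

  -- Induction on a list of all bars still possible between `u` and `v`: a candidate that is there
  -- splits the path in two, any other is dropped. The slab bounds serve `no-bar-inside-edge`.
  slab-path : ∀ {t} (candidates : List (Fin n)) {u v} → Column t u → Column t v → Y u ≺ Y v →
    (∀ {w} → Column t w → Y u ≺ Y w → Y w ≺ Y v → w ∈ candidates) →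
    ¬ ¬ Star (Within (Slab t (Y u) (Y v))) u v
  slab-path [] u∈ v∈ Yu≺Yv listed k =
    consecutive⇒adj u∈ v∈ Yu≺Yv (λ w∈ l r → case-∈[] (listed w∈ l r)) λ u~v →
    k ((u~v , (u∈ , ≼-refl , ≺⇒≼ Yu≺Yv) , (v∈ , ≺⇒≼ Yu≺Yv , ≼-refl)) ◅ Star.ε)
    where
    case-∈[] : ∀ {w} → ¬ (w ∈ [])
    case-∈[] ()
  slab-path {t} (w ∷ candidates) {u} {v} u∈ v∈ Yu≺Yv listed k =
    ¬¬-excluded-middle {A = Column t w × Y u ≺ Y w × Y w ≺ Y v} λ
    { (yes (w∈ , Yu≺Yw , Yw≺Yv)) →
        slab-path candidates u∈ w∈ Yu≺Yw
          (λ z∈ l r → listed-later (λ { refl → ≺-irrefl r }) (listed z∈ l (≺-trans r Yw≺Yv))) λ p →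
        slab-path candidates w∈ v∈ Yw≺Yv
          (λ z∈ l r → listed-later (λ { refl → ≺-irrefl l }) (listed z∈ (≺-trans Yu≺Yw l) r)) λ q →
        k (Within-map (λ (z∈ , l , r) → z∈ , l , ≼-trans r (≺⇒≼ Yw≺Yv)) p ◅◅
           Within-map (λ (z∈ , l , r) → z∈ , ≼-trans (≺⇒≼ Yu≺Yw) l , r) q)
    ; (no w∉) → slab-path candidates u∈ v∈ Yu≺Yv
        (λ z∈ l r → listed-later (λ { refl → w∉ (z∈ , l , r) }) (listed z∈ l r)) k
    }
    where
    listed-later : ∀ {z} → z ≢ w → z ∈ w ∷ candidates → z ∈ candidates
    listed-later z≢w (here z≡w) = ⊥-elim (z≢w z≡w)
    listed-later z≢w (there z∈) = z∈

  ascend : ∀ {t u v} → Column t u → Column t v → Y u ≺ Y v → ¬ ¬ Star (Within (Slab t (Y u) (Y v))) u v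
  ascend u∈ v∈ Yu≺Yv = slab-path (allFin n) u∈ v∈ Yu≺Yv (λ {w} _ _ _ → ∈-allFin w)

  height-compare : ∀ {u v x} → u ≢ v → u ∋ x → v ∋ x → ¬ ¬ (Y u ≺ Y v ⊎ Y v ≺ Y u)
  height-compare u≢v u∋x v∋x k = heights-differ u≢v u∋x v∋x (k ∘ inj₁) (k ∘ inj₂)

  column-connected : ∀ {t u v} → Column t u → Column t v → ¬ ¬ Star (Within (Column t)) u v
  column-connected {t} {u} {v} u∈ v∈ k = ¬¬-excluded-middle {A = u ≡ v} λ
    { (yes refl) → k Star.ε
    ; (no u≢v) → height-compare u≢v (Column⇒∋ u∈) (Column⇒∋ v∈)
        [ (λ Yu≺Yv → ascend u∈ v∈ Yu≺Yv (k ∘ Within-map proj₁))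
        , (λ Yv≺Yu → ascend v∈ u∈ Yv≺Yu (k ∘ Within-reverse ∘ Within-map proj₁)) ]′
    }

  -- If the edges differ, go from `a` to `a′` in the column at `t`, along the second edge, and from
  -- `c′` to `c` in the column at `t +ℚ 1ℚ`. The first column misses `c`, which starts after `t`;
  -- the second misses `a`, which ends by `t +ℚ 1ℚ`. This bypasses a bridge.
  crossing-unique : ∀ {t a c a′ c′} → Adj a c → Adj a′ c′ →
    X a ≼ t → t ≺ X c → X a′ ≼ t → t ≺ X c′ → a ≡ a′ × c ≡ c′
  crossing-unique {t} {a} {c} {a′} {c′} a~c a′~c′ a≼t t≺c a′≼t t≺c′ =
    decidable-stable (a ≟ a′ ×-dec c ≟ c′) λ distinct →
    column-connected (near a~c a≼t t≺c) (near a′~c′ a′≼t t≺c′) λ p →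
    column-connected (far a′~c′ a′≼t t≺c′) (far a~c a≼t t≺c) λ q →
    edge-is-bridge G acyclic (symm a~c)
      (Star.map (λ (u~v , (lu , _) , (lv , _)) → u~v ,
         (λ { (refl , _) → lu t≺c }) , (λ { (_ , refl) → lv t≺c })) p ◅◅
       ((a′~c′ , (λ { (refl , _) → a′≼t t≺c }) , (λ { (refl , refl) → distinct (refl , refl) })) ◅
       Star.map (λ (u~v , (_ , ru) , (_ , rv)) → u~v ,
         (λ { (_ , refl) → a≼t (+1-cancel-≺ rv) }) , (λ { (refl , _) → a≼t (+1-cancel-≺ ru) })) q))
    where
    near : ∀ {u v} → Adj u v → X u ≼ t → t ≺ X v → Column t u
    near u~v u≼t t≺v = u≼t , ≺-trans t≺v (overlapping (symm u~v))
    far : ∀ {u v} → Adj u v → X u ≼ t → t ≺ X v → Column (t +ℚ 1ℚ) v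
    far u~v u≼t t≺v = ≺⇒≼ (≺-≼-trans (overlapping (symm u~v)) (+1-mono-≼ u≼t)) , +1-mono-≺ t≺v

  -- The edge may have its line of sight away from `t`, so visibility alone does not exclude `r`.
  -- But the climb from `u` to `r` misses `v` and the climb from `r` to `v` misses `u`; together
  -- they bypass a bridge.
  no-bar-inside-edge : ∀ {t u r v} → Adj u v → Column t u → Column t r → Column t v →
    Y u ≺ Y r → ¬ Y r ≺ Y v
  no-bar-inside-edge u~v u∈ r∈ v∈ Yu≺Yr Yr≺Yv =
    ascend u∈ r∈ Yu≺Yr λ p → ascend r∈ v∈ Yr≺Yv λ q →
    edge-is-bridge G acyclic (symm u~v)
      (Star.map (λ (w~z , (_ , _ , w≼r) , (_ , _ , z≼r)) → w~z ,
         (λ { (refl , _) → w≼r Yr≺Yv }) , (λ { (_ , refl) → z≼r Yr≺Yv })) p ◅◅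
       Star.map (λ (w~z , (_ , r≼w , _) , (_ , r≼z , _)) → w~z ,
         (λ { (_ , refl) → r≼z Yu≺Yr }) , (λ { (refl , _) → r≼w Yu≺Yr })) q)

  -- `t` is the larger of the two left ends.
  common-column : ∀ {v r} → Adj v r → ¬ ¬ (∃[ t ] (Column t v × Column t r))
  common-column {v} {r} v~r k = ¬¬-excluded-middle {A = X v ≺ X r} λ
    { (yes v≺r) → k (X r , (≺⇒≼ v≺r , overlapping (symm v~r)) , (≼-refl , x≺x+1))
    ; (no r≼v) → k (X v , (≼-refl , x≺x+1) , (r≼v , overlapping v~r))
    }

  Column-aligned : ∀ {t v u} → Aligned v u → Column t v → Column t u
  Column-aligned (¬v◃u , ¬u◃v) (l , r) = ≼-trans ¬v◃u l , ≺-≼-trans r (+1-mono-≼ ¬u◃v)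

  -- An aligned neighbour shares every column of v, so another neighbour on the same side of v
  -- would either be hidden behind it or stand between it and v.
  aligned-alone : ∀ {v u r} → Aligned v u → Adj v u → Adj v r → u ≢ r →
    ¬ (Y v ≺ Y u × Y v ≺ Y r ⊎ Y u ≺ Y v × Y r ≺ Y v)
  aligned-alone {v} {u} {r} v∥u v~u v~r u≢r sides = common-column v~r λ (t , v∈ , r∈) →
    let u∈ = Column-aligned v∥u v∈
        hidden = aligned-blocks v∥u v~r (adj⇒≢ (symm v~u)) u≢r in
    height-compare u≢r (Column⇒∋ u∈) (Column⇒∋ r∈)
    [ (λ Yu≺Yr → [ (λ (Yv≺Yu , _) → hidden (inj₁ (Yv≺Yu , Yu≺Yr)))
                 , (λ (_ , Yr≺Yv) → no-bar-inside-edge (symm v~u) u∈ r∈ v∈ Yu≺Yr Yr≺Yv) ]′ sides)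
    , (λ Yr≺Yu → [ (λ (_ , Yv≺Yr) → no-bar-inside-edge v~u v∈ r∈ u∈ Yv≺Yr Yr≺Yu)
                 , (λ (Yu≺Yv , _) → hidden (inj₂ (Yr≺Yu , Yu≺Yv))) ]′ sides) ]′

  vertical-sides : ∀ {v u} → Adj v u → ¬ ¬ (Y v ≺ Y u ⊎ Y u ≺ Y v)
  vertical-sides v~u k = let _ , _ , _ , (v∋x , u∋x) , _ = sight v~u in
    height-compare (adj⇒≢ v~u) v∋x u∋x k

  -- Of three neighbours, two lie on the same vertical side of `v`. Each pair contains `u` or `r`,
  -- so `aligned-alone` rules it out.
  two-aligned⇒no-third : ∀ {v u r s} → Adj v u → Adj v r → Adj v s → Aligned v u → Aligned v r →
    u ≢ r → u ≢ s → r ≢ s → ⊥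
  two-aligned⇒no-third v~u v~r v~s v∥u v∥r u≢r u≢s r≢s =
    vertical-sides v~u λ u-side → vertical-sides v~r λ r-side → vertical-sides v~s λ s-side →
    let ur = aligned-alone v∥u v~u v~r u≢r
        us = aligned-alone v∥u v~u v~s u≢s
        rs = aligned-alone v∥r v~r v~s r≢s
    in sort ur us rs u-side r-side s-side
    where
    sort : ∀ {A A′ B B′ C C′ : Set} → ¬ (A × B ⊎ A′ × B′) → ¬ (A × C ⊎ A′ × C′) → ¬ (B × C ⊎ B′ × C′) →
      A ⊎ A′ → B ⊎ B′ → C ⊎ C′ → ⊥
    sort ab ac bc (inj₁ a) (inj₁ b) _        = ab (inj₁ (a , b))
    sort ab ac bc (inj₂ a) (inj₂ b) _        = ab (inj₂ (a , b))
    sort ab ac bc (inj₁ a) (inj₂ b) (inj₁ c) = ac (inj₁ (a , c))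
    sort ab ac bc (inj₁ a) (inj₂ b) (inj₂ c) = bc (inj₂ (b , c))
    sort ab ac bc (inj₂ a) (inj₁ b) (inj₁ c) = bc (inj₁ (b , c))
    sort ab ac bc (inj₂ a) (inj₁ b) (inj₂ c) = ac (inj₂ (a , c))

  -- Both edges cross the abscissa `X v`. Bars starting right of `v` can thus be reached only along
  -- the edge from `v` to `r`.
  right-gate : ∀ {v r p w} → Adj v r → v ◃ r → Adj p w → ¬ v ◃ p → v ◃ w → p ≡ v × w ≡ r
  right-gate v~r v◃r p~w ¬v◃p v◃w = crossing-unique p~w v~r ¬v◃p v◃w ≼-refl v◃r

  -- Crossing is not symmetric in left and right, so the mirror image needs another abscissa: the
  -- larger of `X l` and `X w`, which still lies below `X v`.
  left-gate : ∀ {v l p w} → Adj v l → l ◃ v → Adj p w → ¬ p ◃ v → w ◃ v → p ≡ v × w ≡ l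
  left-gate {v} {l} {p} {w} v~l l◃v p~w ¬p◃v w◃v = decidable-stable (p ≟ v ×-dec w ≟ l) λ distinct →
    ¬¬-excluded-middle {A = l ◃ w} λ
    { (yes l◃w) → distinct (swap (crossing-unique (symm p~w) (symm v~l) ≼-refl (≺-≼-trans w◃v ¬p◃v) (≺⇒≼ l◃w) w◃v))
    ; (no ¬l◃w) → distinct (swap (crossing-unique (symm p~w) (symm v~l) ¬l◃w (≺-≼-trans l◃v ¬p◃v) ≼-refl l◃v))
    }

-- Levels of the tree

Distinct : ∀ {A : Set} → A → A → A → Set
Distinct x y z = x ≢ y × x ≢ z × y ≢ z

distinct-exhaust : ∀ (x y z w : Fin 3) → Distinct x y z → w ≡ x ⊎ w ≡ y ⊎ w ≡ z
distinct-exhaust = from-yes (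
  Fin.all? λ (x : Fin 3) → Fin.all? λ (y : Fin 3) → Fin.all? λ (z : Fin 3) → Fin.all? λ (w : Fin 3) →
  (¬? (x ≟ y) ×-dec ¬? (x ≟ z) ×-dec ¬? (y ≟ z)) →-dec (w ≟ x ⊎-dec w ≟ y ⊎-dec w ≟ z))

indicator : ∀ {P : Set} → Dec P → ℕ
indicator d = if does d then 1 else 0

indicator≤1 : ∀ {P : Set} (d : Dec P) → indicator d ≤ 1
indicator≤1 (yes _) = ℕ.≤-refl
indicator≤1 (no _)  = ℕ.z≤n

indicator-transfer : ∀ {P Q : Set} (p? : Dec P) (q? : Dec Q) → indicator p? ≡ indicator q? → P → Q
indicator-transfer (yes _) (yes q) _ _ = q
indicator-transfer (no ¬p) _       _ p = ⊥-elim (¬p p)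

least : (P : ℕ → Set) → (∀ k → Dec (P k)) → ∀ k → P k → ∃[ m ] (P m × ∀ j → P j → m ≤ j)
least P P? zero    Pk = 0 , Pk , λ _ _ → ℕ.z≤n
least P P? (suc k) Pk with P? 0
... | yes P0 = 0 , P0 , λ _ _ → ℕ.z≤n
... | no ¬P0 with least (P ∘ suc) (P? ∘ suc) k Pk
...   | m , Pm , m≤ = suc m , Pm , λ { zero P0 → ⊥-elim (¬P0 P0) ; (suc j) Pj → ℕ.s≤s (m≤ j Pj) }

module _ {A : Set} where

  lookup-injective : ∀ {xs : List A} → Unique xs → ∀ {i j} → lookup xs i ≡ lookup xs j → i ≡ j
  lookup-injective (x∉ ∷ _) {zero}  {zero}  _  = refl
  lookup-injective (x∉ ∷ _) {zero}  {suc j} eq = ⊥-elim (All.lookup x∉ (∈-lookup j) eq)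
  lookup-injective (x∉ ∷ _) {suc i} {zero}  eq = ⊥-elim (All.lookup x∉ (∈-lookup i) (sym eq))
  lookup-injective (_ ∷ u)  {suc i} {suc j} eq = cong suc (lookup-injective u eq)

  length≤bound : ∀ {xs : List A} {N} (f : A → ℕ) → Unique xs → (∀ {x} → x ∈ xs → f x ℕ.< N) →
    (∀ {x y} → x ∈ xs → y ∈ xs → f x ≡ f y → x ≡ y) → length xs ≤ N
  length≤bound f unique bound injective = Fin.injective⇒≤
    {f = λ i → Fin.fromℕ< (bound (∈-lookup i))} λ {i} {j} eq →
    lookup-injective unique (injective (∈-lookup i) (∈-lookup j)
      (Fin.fromℕ<-injective _ _ (bound (∈-lookup i)) (bound (∈-lookup j)) eq))

-- Distances and parents in a rooted tree

module Distance {n : ℕ} (G : SimpleGraph n) (acyclic : Acyclic G) (connected : Connected G) (root : Fin n) where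

  open SimpleGraph G

  private
    W = Walk G

  snoc : ∀ {u v w k} → W u v k → Adj v w → W u w (suc k)
  snoc stay         v~w = step v~w stay
  snoc (step u~ p)  v~w = step u~ (snoc p v~w)

  reverse-walk : ∀ {u v k} → W u v k → W v u k
  reverse-walk stay         = stay
  reverse-walk (step u~v p) = snoc (reverse-walk p) (symm u~v)

  walk? : ∀ u v k → Dec (W u v k)
  walk? u v zero with u ≟ v
  ... | yes refl = yes stay
  ... | no u≢v   = no λ { stay → u≢v refl }
  walk? u v (suc k) with Fin.any? (λ w → adj? u w ×-dec walk? w v k)
  ... | yes (w , u~w , p) = yes (step u~w p)
  ... | no ¬p             = no λ { (step u~w p) → ¬p (_ , u~w , p) }

  shortest : ∀ v → ∃[ m ] (W v root m × ∀ j → W v root j → m ≤ j)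
  shortest v = let k , p = connected v root in least (W v root) (walk? v root) k p

  dist : Fin n → ℕ
  dist v = proj₁ (shortest v)

  dist-walk : ∀ v → W v root (dist v)
  dist-walk v = proj₁ (proj₂ (shortest v))

  dist-least : ∀ v {j} → W v root j → dist v ≤ j
  dist-least v = proj₂ (proj₂ (shortest v)) _

  dist-isDistance : ∀ v → IsDistance G root v (dist v)
  dist-isDistance v = reverse-walk (dist-walk v) , λ k p → dist-least v (reverse-walk p)

  dist≡0⇒root : ∀ {v} → dist v ≡ 0 → v ≡ root
  dist≡0⇒root {v} eq with dist v | dist-walk v
  dist≡0⇒root refl | _ | stay = refl

  first : ∀ {u v k} → W u v k → Fin n
  -- Default for the empty walk: the root becomes its own parent.
  first {u} stay             = u
  first     (step {v = w} _ _) = w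

  parent : Fin n → Fin n
  parent v = first (dist-walk v)

  adj-parent : ∀ {v d} → dist v ≡ suc d → Adj v (parent v)
  adj-parent {v} eq with dist v | dist-walk v
  adj-parent refl | _ | step v~p _ = v~p

  walk-parent : ∀ {v d} → dist v ≡ suc d → W (parent v) root d
  walk-parent {v} eq with dist v | dist-walk v
  walk-parent refl | _ | step _ p = p

  dist-parent : ∀ {v d} → dist v ≡ suc d → dist (parent v) ≡ d
  dist-parent {v} eq = ℕ.≤-antisym (dist-least _ (walk-parent eq))
    (ℕ.s≤s⁻¹ (subst (_≤ suc (dist (parent v))) eq (dist-least v (step (adj-parent eq) (dist-walk _)))))

  -- The bound `D` records that a descent never gets farther from the root than its start;
  -- `lower-neighbour-unique` uses this to keep off the edge from `v` to `p`.
  Descent : ℕ → Rel (Fin n) 0ℓ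
  Descent D u v = Adj u v × dist v ℕ.< dist u × dist u ≤ D

  descent : ∀ {D} d {v} → dist v ≡ d → d ≤ D → Star (Descent D) v root
  descent zero    eq d≤D rewrite dist≡0⇒root eq = Star.ε
  descent {D} (suc d) {v} eq d<D =
    (adj-parent eq , ℕ.≤-reflexive (trans (cong suc (dist-parent eq)) (sym eq)) , subst (_≤ D) (sym eq) d<D) ◅
    descent d (dist-parent eq) (ℕ.<⇒≤ d<D)

  -- Otherwise v and p would be joined through the root, off the edge between them.
  lower-neighbour-unique : ∀ {v p q} → Adj v p → dist p ≤ dist v → Adj v q → dist q ℕ.< dist v → p ≡ q
  lower-neighbour-unique {v} {p} {q} v~p p≤v v~q q<v = decidable-stable (p ≟ q) λ p≢q →
    edge-is-bridge G acyclic (symm v~p)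
      ((v~q , (λ (v≡p , _) → irrefl v≡p v~p) , (λ (_ , q≡p) → p≢q (sym q≡p))) ◅
       Star.map (λ (x~y , y<x , x≤q) → x~y ,
         (λ { (refl , refl) → ℕ.<⇒≱ y<x p≤v }) , (λ { (refl , _) → ℕ.<⇒≱ q<v x≤q }))
         (descent (dist q) refl ℕ.≤-refl) ◅◅
       Star.reverse (λ (x~y , y<x , x≤p) → symm x~y ,
         (λ { (refl , refl) → ℕ.<⇒≱ y<x x≤p }) , (λ { (refl , refl) → ℕ.<⇒≱ y<x p≤v }))
         (descent (dist p) refl ℕ.≤-refl))

  adj⇒parent : ∀ {v p} → Adj v p → dist p ≤ dist v → (∃[ d ] dist v ≡ suc d) × p ≡ parent v
  adj⇒parent {v} {p} v~p p≤v = go (dist v) refl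
    where
    go : ∀ d → dist v ≡ d → (∃[ d ] dist v ≡ suc d) × p ≡ parent v
    go zero    eq = ⊥-elim (irrefl (trans (dist≡0⇒root eq)
      (sym (dist≡0⇒root (ℕ.n≤0⇒n≡0 (subst (dist p ≤_) eq p≤v))))) v~p)
    go (suc d) eq = (d , eq) , lower-neighbour-unique v~p p≤v (adj-parent eq)
      (ℕ.≤-reflexive (trans (cong suc (dist-parent eq)) (sym eq)))

  -- The parents of `w` lead to the root, which is not beyond `v`, and the gate forces this path to
  -- come back through `v`. Hence `v` is a proper ancestor of `w`. The relation is arbitrary so as
  -- to serve both directions.
  gate-closer : ∀ {_⊏_ : Rel (Fin n) 0ℓ} → Decidable _⊏_ → ∀ {v} →
    (∀ {p w} → Adj p w → ¬ v ⊏ p → v ⊏ w → p ≡ v) → ¬ v ⊏ root →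
    ∀ d {w} → dist w ≡ d → v ⊏ w → dist v ℕ.< dist w
  gate-closer {_⊏_} _ {v} gate v⊀root zero eq v⊏w = ⊥-elim (v⊀root (subst (v ⊏_) (dist≡0⇒root eq) v⊏w))
  gate-closer _⊏?_ {v} gate v⊀root (suc d) {w} eq v⊏w with v ⊏? parent w
  ... | yes v⊏p = ℕ.<-trans (gate-closer _⊏?_ gate v⊀root d (dist-parent eq) v⊏p)
    (ℕ.≤-reflexive (trans (cong suc (dist-parent eq)) (sym eq)))
  ... | no v⊀p  = ℕ.≤-reflexive (trans (cong (suc ∘ dist) (sym (gate (symm (adj-parent eq)) v⊀p v⊏w)))
    (trans (cong suc (dist-parent eq)) (sym eq)))

  module Levels (_◃_ : Rel (Fin n) 0ℓ) (_◃?_ : Decidable _◃_)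
    (◃-irrefl : ∀ {u} → ¬ u ◃ u)
    (◃-trans : Transitive _◃_)
    (◃-cotrans : ∀ {u w} → u ◃ w → ∀ v → u ◃ v ⊎ v ◃ w)
    (right-gate : ∀ {v r p w} → Adj v r → v ◃ r → Adj p w → ¬ v ◃ p → v ◃ w → p ≡ v × w ≡ r)
    (left-gate : ∀ {v l p w} → Adj v l → l ◃ v → Adj p w → ¬ p ◃ v → w ◃ v → p ≡ v × w ≡ l)
    (two-aligned⇒no-third : ∀ {v u r s} → Adj v u → Adj v r → Adj v s →
      ¬ v ◃ u × ¬ u ◃ v → ¬ v ◃ r × ¬ r ◃ v → u ≢ r → u ≢ s → r ≢ s → ⊥)
    where

    -- Degrees and two-sided vertices

    kind : Fin n → Fin n → Fin 3
    kind v u with u ◃? v | v ◃? u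
    ... | yes _ | _     = zero
    ... | no _  | yes _ = suc zero
    ... | no _  | no _  = suc (suc zero)

    kind-left : ∀ {v u} → zero ≡ kind v u → u ◃ v
    kind-left {v} {u} eq with u ◃? v | v ◃? u
    kind-left eq | yes u◃v | _     = u◃v
    kind-left () | no _    | yes _
    kind-left () | no _    | no _

    kind-right : ∀ {v u} → suc zero ≡ kind v u → v ◃ u
    kind-right {v} {u} eq with u ◃? v | v ◃? u
    kind-right () | yes _ | _
    kind-right eq | no _  | yes v◃u = v◃u
    kind-right () | no _  | no _

    -- Two neighbours on the left coincide by `left-gate`, two on the right by `right-gate`. Two
    -- aligned ones are excluded by the presence of the third neighbour `s`.
    kind-injective : ∀ {v u r s} → Adj v u → Adj v r → Adj v s → Distinct u r s → kind v u ≢ kind v r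
    kind-injective {v} {u} {r} v~u v~r v~s (u≢r , u≢s , r≢s) eq
      with u ◃? v | v ◃? u | r ◃? v | v ◃? r
    kind-injective v~u v~r v~s (u≢r , u≢s , r≢s) eq | yes u◃v | _ | yes r◃v | _ =
      u≢r (proj₂ (left-gate v~r r◃v v~u ◃-irrefl u◃v))
    kind-injective v~u v~r v~s (u≢r , u≢s , r≢s) eq | no _ | yes v◃u | no _ | yes v◃r =
      u≢r (proj₂ (right-gate v~r v◃r v~u ◃-irrefl v◃u))
    kind-injective v~u v~r v~s (u≢r , u≢s , r≢s) eq | no ¬uv | no ¬vu | no ¬rv | no ¬vr =
      two-aligned⇒no-third v~u v~r v~s (¬vu , ¬uv) (¬vr , ¬rv) u≢r u≢s r≢s
    kind-injective v~u v~r v~s _ () | yes _ | _ | no _ | yes _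
    kind-injective v~u v~r v~s _ () | yes _ | _ | no _ | no _
    kind-injective v~u v~r v~s _ () | no _ | yes _ | yes _ | _
    kind-injective v~u v~r v~s _ () | no _ | yes _ | no _ | no _
    kind-injective v~u v~r v~s _ () | no _ | no _ | yes _ | _
    kind-injective v~u v~r v~s _ () | no _ | no _ | no _ | yes _

    kinds-distinct : ∀ {v u r s} → Adj v u → Adj v r → Adj v s → Distinct u r s →
      Distinct (kind v u) (kind v r) (kind v s)
    kinds-distinct v~u v~r v~s (u≢r , u≢s , r≢s) =
      kind-injective v~u v~r v~s (u≢r , u≢s , r≢s) ,
      kind-injective v~u v~s v~r (u≢s , u≢r , r≢s ∘ sym) ,
      kind-injective v~r v~s v~u (r≢s , u≢r ∘ sym , u≢s ∘ sym)

    TwoSided : Fin n → Set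
    TwoSided v = (∃[ l ] (Adj v l × l ◃ v)) × (∃[ r ] (Adj v r × v ◃ r))

    three-neighbours⇒two-sided : ∀ {v u r s} → Adj v u → Adj v r → Adj v s → Distinct u r s → TwoSided v
    three-neighbours⇒two-sided {v} {u} {r} {s} v~u v~r v~s distinct =
      pick kind-left (exhaust zero) , pick kind-right (exhaust (suc zero))
      where
      exhaust : ∀ k → k ≡ kind v u ⊎ k ≡ kind v r ⊎ k ≡ kind v s
      exhaust k = distinct-exhaust _ _ _ k (kinds-distinct v~u v~r v~s distinct)
      pick : ∀ {k} {P : Fin n → Set} → (∀ {z} → k ≡ kind v z → P z) →
        k ≡ kind v u ⊎ k ≡ kind v r ⊎ k ≡ kind v s → ∃[ z ] (Adj v z × P z)
      pick f (inj₁ eq)        = u , v~u , f eq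
      pick f (inj₂ (inj₁ eq)) = r , v~r , f eq
      pick f (inj₂ (inj₂ eq)) = s , v~s , f eq

    no-four-neighbours : ∀ {v u r s z} → Adj v u → Adj v r → Adj v s → Adj v z → Distinct u r s →
      z ≢ u → z ≢ r → z ≢ s → ⊥
    no-four-neighbours {v} {z = z} v~u v~r v~s v~z distinct@(u≢r , u≢s , r≢s) z≢u z≢r z≢s
      with distinct-exhaust _ _ _ (kind v z) (kinds-distinct v~u v~r v~s distinct)
    ... | inj₁ eq        = kind-injective v~z v~u v~r (z≢u , z≢r , u≢r) eq
    ... | inj₂ (inj₁ eq) = kind-injective v~z v~r v~s (z≢r , z≢s , r≢s) eq
    ... | inj₂ (inj₂ eq) = kind-injective v~z v~s v~r (z≢s , z≢r , r≢s ∘ sym) eq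

    side : Fin n → ℕ
    side v = indicator (root ◃? v)

    -- If `v′` is not right of the root, its left gate separates `v` from the root and `v` is
    -- farther away. Otherwise `v` is right of the root too, and its right gate makes `v′` farther
    -- away.
    two-sided-not-left : ∀ {v v′} → TwoSided v → TwoSided v′ → dist v ≡ dist v′ → side v ≡ side v′ → ¬ v ◃ v′
    two-sided-not-left {v} {v′} (_ , r , v~r , v◃r) ((l , v′~l , l◃v′) , _) same-dist same-side v◃v′
      with root ◃? v′
    ... | no ¬root◃v′ = ℕ.<-irrefl (sym same-dist)
      (gate-closer (λ x y → y ◃? x) (λ p~w ¬p◃v′ w◃v′ → proj₁ (left-gate v′~l l◃v′ p~w ¬p◃v′ w◃v′))
        ¬root◃v′ (dist v) refl v◃v′)
    ... | yes root◃v′ = ℕ.<-irrefl same-dist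
      (gate-closer _◃?_ (λ p~w ¬v◃p v◃w → proj₁ (right-gate v~r v◃r p~w ¬v◃p v◃w))
        (λ v◃root → ◃-irrefl (◃-trans v◃root root◃v)) (dist v′) refl v◃v′)
      where
      root◃v : root ◃ v
      root◃v = indicator-transfer (yes root◃v′) (root ◃? v) (sym same-side) root◃v′

    -- The two bars are aligned, so `r′` is also right of `v`, and the edge from `v′` to it must be
    -- the right gate of `v`.
    two-sided-unique : ∀ {v v′} → TwoSided v → TwoSided v′ → dist v ≡ dist v′ → side v ≡ side v′ → v ≡ v′
    two-sided-unique {v} {v′} two@(_ , r , v~r , v◃r) two′@(_ , r′ , v′~r′ , v′◃r′) same-dist same-side =
      sym (proj₁ (right-gate v~r v◃r v′~r′ ¬v◃v′
        ([ ⊥-elim ∘ ¬v′◃v , id ]′ (◃-cotrans v′◃r′ v))))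
      where
      ¬v◃v′ = two-sided-not-left two two′ same-dist same-side
      ¬v′◃v = two-sided-not-left two′ two (sym same-dist) (sym same-side)

    -- Numbering the vertices level by level

    Sibling : Rel (Fin n) 0ℓ
    Sibling u v = parent u ≡ parent v × dist u ≡ dist v

    -- Position among siblings in index order: `Later` from the second on, `Last` from the third on.
    Later Last : Fin n → Set
    Later v = ∃[ u ] (u Fin.< v × Sibling u v)
    Last v = ∃[ u ] (u Fin.< v × Sibling u v × Later u)

    later? : ∀ v → Dec (Later v)
    later? v = Fin.any? λ u → u Fin.<? v ×-dec (parent u ≟ parent v ×-dec dist u ℕ.≟ dist v)

    last? : ∀ v → Dec (Last v)
    last? v = Fin.any? λ u → u Fin.<? v ×-dec (parent u ≟ parent v ×-dec dist u ℕ.≟ dist v) ×-dec later? u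

    adj-sibling : ∀ {u v d} → Sibling u v → dist v ≡ suc d → Adj (parent v) u
    adj-sibling (same-parent , same-dist) eq =
      subst (λ p → Adj p _) same-parent (symm (adj-parent (trans same-dist eq)))

    -- Two later vertices of a level are told apart by their rank under the root, and
    -- elsewhere by the side of the root on which their two-sided parents lie.
    tag : ℕ → Fin n → ℕ
    tag zero    v = indicator (last? v)
    tag (suc _) v = side (parent v)

    tag≤1 : ∀ d v → tag d v ≤ 1
    tag≤1 zero    v = indicator≤1 (last? v)
    tag≤1 (suc _) v = indicator≤1 (root ◃? parent v)

    <⇒≢ : ∀ {u v : Fin n} → u Fin.< v → u ≢ v
    <⇒≢ u<v refl = Fin.<-irrefl refl u<v

    later-two-sided : ∀ {v d} → dist v ≡ suc (suc d) → Later v → TwoSided (parent v)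
    later-two-sided {v} eq (u , u<v , sib) = three-neighbours⇒two-sided
      (adj-sibling sib eq) (symm (adj-parent eq)) (adj-parent (dist-parent eq))
      (<⇒≢ u<v , below (trans (proj₂ sib) eq) , below eq)
      where
      below : ∀ {x} → dist x ≡ suc (suc _) → x ≢ parent (parent v)
      below eq′ refl = ℕ.m≢1+n+m _ {1} (trans (sym (dist-parent (dist-parent eq))) eq′)

    later-not-less : ∀ d {v v′} → dist v ≡ suc d → dist v′ ≡ suc d → Later v → Later v′ → tag d v ≡ tag d v′ →
      ¬ v Fin.< v′
    -- Under the root, `v` makes `v′` a `Last` vertex, so by equal tags `v` is one too, and with
    -- `v′` the root has four children.
    later-not-less zero {v} {v′} eq eq′ later later′ same-tag v<v′
      with indicator-transfer (last? v′) (last? v) (sym same-tag) (v , v<v′ , v∼v′ , later)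
      where
      v∼v′ : Sibling v v′
      v∼v′ = trans (dist≡0⇒root (dist-parent eq)) (sym (dist≡0⇒root (dist-parent eq′))) , trans eq (sym eq′)
    ... | w , w<v , w∼v , u , u<w , u∼w = no-four-neighbours
      (adj-sibling (trans (proj₁ u∼w) (proj₁ w∼v) , trans (proj₂ u∼w) (proj₂ w∼v)) eq)
      (adj-sibling w∼v eq) (symm (adj-parent eq))
      (adj-sibling (trans (dist≡0⇒root (dist-parent eq′)) (sym (dist≡0⇒root (dist-parent eq))) , trans eq′ (sym eq)) eq)
      (<⇒≢ u<w , <⇒≢ (Fin.<-trans u<w w<v) , <⇒≢ w<v)
      (<⇒≢ (Fin.<-trans u<w (Fin.<-trans w<v v<v′)) ∘ sym)
      (<⇒≢ (Fin.<-trans w<v v<v′) ∘ sym) (<⇒≢ v<v′ ∘ sym)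
    -- The two-sided parents agree in distance and side, so they coincide; that vertex is adjacent
    -- to `u`, `v`, `v′` and its own parent.
    later-not-less (suc d) {v} {v′} eq eq′ later@(u , u<v , u∼v) later′ same-tag v<v′ = no-four-neighbours
      (adj-sibling u∼v eq) (symm (adj-parent eq))
      (adj-sibling (sym same-parent , trans eq′ (sym eq)) eq) (adj-parent (dist-parent eq))
      (<⇒≢ u<v , <⇒≢ (Fin.<-trans u<v v<v′) , <⇒≢ v<v′)
      (above (trans (proj₂ u∼v) eq)) (above eq) (above eq′)
      where
      same-parent : parent v ≡ parent v′
      same-parent = two-sided-unique (later-two-sided eq later) (later-two-sided eq′ later′)
        (trans (dist-parent eq) (sym (dist-parent eq′))) same-tag
      above : ∀ {x} → dist x ≡ suc (suc d) → parent (parent v) ≢ x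
      above eq″ refl = ℕ.m≢1+n+m d {1} (trans (sym (dist-parent (dist-parent eq))) eq″)

    later-unique : ∀ d {v v′} → dist v ≡ suc d → dist v′ ≡ suc d → Later v → Later v′ → tag d v ≡ tag d v′ → v ≡ v′
    later-unique d {v} {v′} eq eq′ later later′ same-tag with Fin.<-cmp v v′
    ... | tri< v<v′ _ _ = ⊥-elim (later-not-less d eq eq′ later later′ same-tag v<v′)
    ... | tri≈ _ v≡v′ _ = v≡v′
    ... | tri> _ _ v′<v = ⊥-elim (later-not-less d eq′ eq later′ later (sym same-tag) v′<v)

    -- A first child inherits the code of its parent, at most `2 * d`; later ones take the two fresh
    -- values `2 * d + 1` and `2 * d + 2`.
    code : ℕ → Fin n → ℕ
    code zero    v = 0
    code (suc d) v with later? v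
    ... | yes _ = suc (2 * d + tag d v)
    ... | no _  = code d (parent v)

    code≤ : ∀ d v → code d v ≤ 2 * d
    code≤ zero    v = ℕ.z≤n
    code≤ (suc d) v with later? v
    ... | yes _ = subst (suc (2 * d + tag d v) ≤_) (double d)
      (ℕ.s≤s (ℕ.+-monoʳ-≤ (2 * d) (tag≤1 d v)))
      where
      double : ∀ d → suc (2 * d + 1) ≡ 2 * suc d
      double = solve 1 (λ d → con 1 :+ (con 2 :* d :+ con 1) := con 2 :* (con 1 :+ d)) refl
        where open +-*-Solver
    ... | no _  = ℕ.≤-trans (code≤ d (parent v)) (ℕ.*-monoʳ-≤ 2 (ℕ.n≤1+n d))

    not-later-first : ∀ {v v′} → ¬ Later v′ → Sibling v v′ → ¬ v Fin.< v′
    not-later-first ¬later v∼v′ v<v′ = ¬later (_ , v<v′ , v∼v′)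

    code-injective : ∀ d {v v′} → dist v ≡ d → dist v′ ≡ d → code d v ≡ code d v′ → v ≡ v′
    code-injective zero eq eq′ _ = trans (dist≡0⇒root eq) (sym (dist≡0⇒root eq′))
    code-injective (suc d) {v} {v′} eq eq′ same with later? v | later? v′
    ... | yes later | yes later′ = later-unique d eq eq′ later later′ (ℕ.+-cancelˡ-≡ (2 * d) _ _ (ℕ.suc-injective same))
    ... | yes _ | no _ = ⊥-elim (ℕ.m+n≮m (2 * d) (tag d v) (subst (_≤ 2 * d) (sym same) (code≤ d (parent v′))))
    ... | no _ | yes _ = ⊥-elim (ℕ.m+n≮m (2 * d) (tag d v′) (subst (_≤ 2 * d) same (code≤ d (parent v))))
    -- Equal inherited codes give equal parents, and a parent has only one first child.
    ... | no ¬later | no ¬later′ with code-injective d (dist-parent eq) (dist-parent eq′) same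
    ...   | same-parent with Fin.<-cmp v v′
    ...     | tri< v<v′ _ _ = ⊥-elim (not-later-first ¬later′ (same-parent , trans eq (sym eq′)) v<v′)
    ...     | tri≈ _ v≡v′ _ = v≡v′
    ...     | tri> _ _ v′<v = ⊥-elim (not-later-first ¬later (sym same-parent , trans eq′ (sym eq)) v′<v)

    -- Level `d` gets numbers from `d * d` to `d * d + 2 * d`, just short of the next square, so
    -- different levels use disjoint blocks.
    number : Fin n → ℕ
    number v = dist v * dist v + code (dist v) v

    number-dist : ∀ {u v} → number u ≡ number v → ¬ dist u ℕ.< dist v
    number-dist {u} {v} eq u<v = ℕ.<-irrefl eq (begin-strict
      d * d + code d u     ≤⟨ ℕ.+-monoʳ-≤ (d * d) (code≤ d u) ⟩
      d * d + 2 * d        <⟨ ℕ.n<1+n _ ⟩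
      suc (d * d + 2 * d)  ≡⟨ square-suc d ⟩
      suc d * suc d        ≤⟨ ℕ.*-mono-≤ u<v u<v ⟩
      dist v * dist v      ≤⟨ ℕ.m≤m+n _ _ ⟩
      number v             ∎)
      where
      open ℕ.≤-Reasoning
      d = dist u
      square-suc : ∀ d → suc (d * d + 2 * d) ≡ suc d * suc d
      square-suc = solve 1 (λ d → con 1 :+ (d :* d :+ con 2 :* d) := (con 1 :+ d) :* (con 1 :+ d)) refl
        where open +-*-Solver

    number-injective : ∀ {u v} → number u ≡ number v → u ≡ v
    number-injective {u} {v} eq = code-injective (dist u) refl (sym same-dist)
      (ℕ.+-cancelˡ-≡ (dist u * dist u) _ _ (trans eq (cong (λ d → d * d + code d v) (sym same-dist))))
      where
      same-dist : dist u ≡ dist v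
      same-dist = ℕ.≤-antisym (ℕ.≮⇒≥ (number-dist (sym eq))) (ℕ.≮⇒≥ (number-dist eq))

    -- Each edge is charged to its endpoint farther from the root. Ties do not occur on edges, by
    -- `adj⇒parent`.
    child : Fin n × Fin n → Fin n
    child (i , j) with dist i ℕ.≤? dist j
    ... | yes _ = j
    ... | no _  = i

    NonRoot : Fin n → Set
    NonRoot v = ∃[ d ] dist v ≡ suc d

    number-positive : ∀ {v} → NonRoot v → suc (ℕ.pred (number v)) ≡ number v
    number-positive {v} (d , eq) = ℕ.suc-pred (number v) {{ℕ.>-nonZero (ℕ.≤-trans (ℕ.*-mono-≤ 1≤dist 1≤dist) (ℕ.m≤m+n _ _))}}
      where
      1≤dist : 1 ≤ dist v
      1≤dist = subst (1 ≤_) (sym eq) (ℕ.s≤s ℕ.z≤n)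

    child-spec : ∀ {i j} → Adj i j → let v = child (i , j) in
      NonRoot v × (v ≡ j × i ≡ parent j ⊎ v ≡ i × j ≡ parent i)
    child-spec {i} {j} i~j with dist i ℕ.≤? dist j
    ... | yes i≤j = let nonroot , i≡parent = adj⇒parent (symm i~j) i≤j in nonroot , inj₁ (refl , i≡parent)
    ... | no i≰j  = let nonroot , j≡parent = adj⇒parent i~j (ℕ.<⇒≤ (ℕ.≰⇒> i≰j)) in nonroot , inj₂ (refl , j≡parent)

    -- A vertex and its parent determine the edge. In the mixed cases the same edge would be listed
    -- in both orders, against the index inequalities.
    child-injective : ∀ {i j i′ j′} → i Fin.< j → Adj i j → i′ Fin.< j′ → Adj i′ j′ →
      child (i , j) ≡ child (i′ , j′) → (i , j) ≡ (i′ , j′)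
    child-injective {i} {j} {i′} {j′} i<j i~j i′<j′ i′~j′ same =
      match (proj₂ (child-spec i~j)) (proj₂ (child-spec i′~j′))
      where
      match : child (i , j) ≡ j × i ≡ parent j ⊎ child (i , j) ≡ i × j ≡ parent i →
        child (i′ , j′) ≡ j′ × i′ ≡ parent j′ ⊎ child (i′ , j′) ≡ i′ × j′ ≡ parent i′ → (i , j) ≡ (i′ , j′)
      match (inj₁ (cj , i≡)) (inj₁ (cj′ , i′≡)) with trans (sym cj) (trans same cj′)
      ... | refl = cong (_, j) (trans i≡ (sym i′≡))
      match (inj₂ (ci , j≡)) (inj₂ (ci′ , j′≡)) with trans (sym ci) (trans same ci′)
      ... | refl = cong (i ,_) (trans j≡ (sym j′≡))
      match (inj₁ (cj , i≡)) (inj₂ (ci′ , j′≡)) with trans (sym cj) (trans same ci′)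
      ... | refl = ⊥-elim (Fin.<-asym i<j (subst (j Fin.<_) (trans j′≡ (sym i≡)) i′<j′))
      match (inj₂ (ci , j≡)) (inj₁ (cj′ , i′≡)) with trans (sym ci) (trans same cj′)
      ... | refl = ⊥-elim (Fin.<-asym i<j (subst (Fin._< i) (trans i′≡ (sym j≡)) i′<j′))

    -- The vertices charged are not the root, so their numbers are positive; taking predecessors
    -- saves one from the `(s + 1)²` possible numbers.
    edgeCount≤ : ∀ s → (∀ v → dist v ≤ s) → edgeCount G ≤ s ^ 2 + 2 * s
    edgeCount≤ s dist≤s = length≤bound (ℕ.pred ∘ number ∘ child)
      (Unique.filter⁺ _ (Unique.cartesianProduct⁺ (Unique.allFin⁺ n) (Unique.allFin⁺ n)))
      (λ e∈ → subst (_≤ s ^ 2 + 2 * s) (sym (suc-pred (proj₂ (edge e∈)))) (bounded _))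
      λ e∈ e′∈ same → child-injective (proj₁ (edge e∈)) (proj₂ (edge e∈)) (proj₁ (edge e′∈)) (proj₂ (edge e′∈))
        (number-injective (trans (sym (suc-pred (proj₂ (edge e∈)))) (trans (cong suc same) (suc-pred (proj₂ (edge e′∈))))))
      where
      edge : ∀ {i j} → (i , j) ∈ edges G → i Fin.< j × Adj i j
      edge e∈ = proj₂ (∈-filter⁻ (λ (i , j) → (i Fin.<? j) ×-dec adj? i j)
        {xs = cartesianProduct (allFin n) (allFin n)} e∈)
      suc-pred : ∀ {i j} → Adj i j → suc (ℕ.pred (number (child (i , j)))) ≡ number (child (i , j))
      suc-pred i~j = number-positive (proj₁ (child-spec i~j))
      bounded : ∀ v → number v ≤ s ^ 2 + 2 * s
      bounded v = ℕ.+-mono-≤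
        (subst (dist v * dist v ≤_) (cong (s *_) (sym (ℕ.*-identityʳ s))) (ℕ.*-mono-≤ (dist≤s v) (dist≤s v)))
        (ℕ.≤-trans (code≤ (dist v) v) (ℕ.*-monoʳ-≤ 2 (dist≤s v)))

¬¬-sequence : ∀ {n} {P : Fin n → Set} → (∀ i → ¬ ¬ P i) → ¬ ¬ (∀ i → P i)
¬¬-sequence = Fin.sequence (RawMonad.rawApplicative ¬¬-Monad)

theorem6p1 : (n s : ℕ) (T : RootedTree n) → HasDepth T s → IsUBVG (RootedTree.graph T) →
    edgeCount (RootedTree.graph T) ≤ s ^ 2 + 2 * s
theorem6p1 n s T (dist≤s , _) (bar , disjoint , adj⇔visible) =
  decidable-stable (_ ℕ.≤? _) λ exceeds →
  -- There are finitely many comparisons of left ends, so all of them may be decided at once under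
  -- the double negation.
  ¬¬-sequence (λ u → ¬¬-sequence λ v → ¬¬-excluded-middle {A = u ◃ v}) λ _◃?_ →
  exceeds (Levels.edgeCount≤ _◃_ _◃?_ ≺-irrefl ≺-trans (λ u◃w v → ≺-cotrans u◃w (X v))
    right-gate left-gate two-aligned⇒no-third s (λ v → dist≤s v (dist v) (dist-isDistance v)))
  where
  open RootedTree T
  open Layout graph acyclic bar disjoint adj⇔visible
  open Distance graph acyclic connected root
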